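{- For every $n\ge 1$ there exists a unique involution $\xi:\mathfrak L_n\to\mathfrak L_n$ such that, whenever $W=(w,h,c)\in\mathfrak L_n$ with $\mathrm{cs}(W)=m$ and $V=\xi(W)=(v,g,b)$, the following hold: (1) $\mathrm{cs}(V)=n+1-m$. (2) For every $j\in[n]$ with $j\neq n+1-m$: $v_j\in\{\mathrm N,\mathrm E\}$ if and only if $w_{n+1-j}\in\{\mathrm S,\mathrm{dE}\}$. (3) For every $j\in[n]$: $g_j=h_{n+1-j}+1$ if $j>n+1-m$ and $v_j\in\{\mathrm S,\mathrm{dE}\}$; $g_j=h_{n+1-j}-1$ if $j<n+1-m$ and $v_j\in\{\mathrm N,\mathrm E\}$; and $g_j=h_{n+1-j}$ otherwise. (4) For every $j\in[n]$: $b_j=g_j-h_{n+1-j}+c_{n+1-j}$.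
   Context: $[n]=\{1,\dots,n\}$. A 2-Motzkin path of length $n$ is a word $w=w_1\cdots w_n$ over the four-letter alphabet $\{\mathrm N,\mathrm S,\mathrm E,\mathrm{dE}\}$ (northeast, southeast, solid east, dotted east steps) such that, with $h_i:=\#\{j<i: w_j=\mathrm N\}-\#\{j<i: w_j=\mathrm S\}$ for $1\le i\le n+1$, one has $h_i\ge 0$ for all $i$ and $h_{n+1}=0$. An sr-Laguerre history of length $n$ is a triple $W=(w,h,c)$ where $w$ is a 2-Motzkin path of length $n$, $h=h_1\cdots h_n$ is its height sequence just defined, and $c=c_1\cdots c_n$ is a sequence of integers with $0\le c_i\le h_i$ if $w_i\in\{\mathrm N,\mathrm E\}$ and $1\le c_i\le h_i$ if $w_i\in\{\mathrm S,\mathrm{dE}\}$. $\mathfrak L_n$ is the set of sr-Laguerre histories of length $n$. The index of the critical step is $\mathrm{cs}(W):=\max\{i\in[n]: c_i=0\}$ (well defined since $c_1=h_1=0$). -}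

module Defs where

open import Data.Fin.Base using (Fin; zero; toℕ)
import Data.Fin.Properties as Fin
open import Data.Integer.Base using (ℤ; +_; 0ℤ; 1ℤ; _-_; _≤_)
import Data.Integer.Properties as ℤ
import Data.List.Extrema as Extrema
open import Data.List.Base using (List; allFin; filter; length; take)
open import Data.Nat.Base as ℕ using (ℕ; suc)
open import Data.Product.Base using (_×_)
open import Data.Sum.Base using (_⊎_)
open import Data.Vec.Base using (Vec; lookup; toList)
open import Relation.Binary.Definitions using (DecidableEquality)
open import Relation.Binary.PropositionalEquality.Core using (_≡_; refl)
open import Relation.Nullary.Decidable.Core using (yes; no)

-- dE is the dotted east step.
data Step : Set where
  N S E dE : Step

_≟_ : DecidableEquality Step
N  ≟ N  = yes refl
N  ≟ S  = no λ ()
N  ≟ E  = no λ ()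
N  ≟ dE = no λ ()
S  ≟ N  = no λ ()
S  ≟ S  = yes refl
S  ≟ E  = no λ ()
S  ≟ dE = no λ ()
E  ≟ N  = no λ ()
E  ≟ S  = no λ ()
E  ≟ E  = yes refl
E  ≟ dE = no λ ()
dE ≟ N  = no λ ()
dE ≟ S  = no λ ()
dE ≟ E  = no λ ()
dE ≟ dE = yes refl

_∈[N,E] : Step → Set
s ∈[N,E] = s ≡ N ⊎ s ≡ E

_∈[S,dE] : Step → Set
s ∈[S,dE] = s ≡ S ⊎ s ≡ dE

occurrences : Step → List Step → ℕ
occurrences s xs = length (filter (_≟ s) xs)

-- The height after the first k steps, i.e. h_{k+1} in 1-based notation.
height : ∀ {n} → Vec Step n → ℕ → ℤ
height w k = + occurrences N prefix - + occurrences S prefix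
  where prefix = take k (toList w)

IsMotzkin : ∀ {n} → Vec Step n → Set
IsMotzkin {n} w =
  ((i : Fin (suc n)) → 0ℤ ≤ height w (toℕ i)) × height w n ≡ 0ℤ

ValidLabels : ∀ {n} → Vec Step n → Vec ℤ n → Set
ValidLabels {n} w c = (i : Fin n) →
  (lookup w i ∈[N,E]  → 0ℤ ≤ lookup c i × lookup c i ≤ height w (toℕ i)) ×
  (lookup w i ∈[S,dE] → 1ℤ ≤ lookup c i × lookup c i ≤ height w (toℕ i))

-- sr-Laguerre histories of length n.  The height sequence is a function of
-- the word, hence not stored.  The two conditions are decidable; they are
-- irrelevant fields so that _≡_ on histories is equality of words and labels.
-- Position i : Fin n stands for the position toℕ i + 1 of [n].
record History (n : ℕ) : Set where
  constructor history
  field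
    word       : Vec Step n
    labels     : Vec ℤ n
    .isMotzkin : IsMotzkin word
    .valid     : ValidLabels word labels

  step : Fin n → Step
  step = lookup word

  ht : Fin n → ℤ
  ht i = height word (toℕ i)

  label : Fin n → ℤ
  label = lookup labels

open History public

-- The base value zero required by max does not matter: the first label is
-- always 0, so zero is itself one of the positions maximised over.
cs : ∀ {n} → History (suc n) → Fin (suc n)
cs {n} W = max zero (filter (λ i → label W i ℤ.≟ 0ℤ) (allFin (suc n)))
  where open Extrema (Fin.≤-totalOrder (suc n)) using (max)

{-# OPTIONS --safe #-}
-- Record a step by the two bits a = [step ∈ {N, E}] and d = [step ∈ {E, S}], so
-- that it changes the height by a − d.  The involution reverses the path, flips
-- the bits a except at the critical step m, and flips the bits d after delaying
-- them by one position.  Telescoping gives for the new height g at position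
-- n+1−k the closed form g = h_k + a_k − [m ≤ k], and the labels are shifted by
-- the same amount a_k − [m ≤ k], which keeps them within their bounds because
-- c_k ≥ 1 for k > m.  Conversely, conditions (1)–(4) force the bits a (the
-- critical label is zero, so its step is N or E), the heights and the labels;
-- the bits d are then height differences.  The closed form is symmetric in the
-- two histories, so uniqueness also yields involutivity.
module Submission where

open import Defs
open import Algebra.Definitions using (Involutive)
open import Data.Fin.Base using (Fin; opposite; _<_; _>_)
open import Data.Integer.Base using (1ℤ; _+_; _-_)
open import Data.Nat.Base using (ℕ; suc)
open import Data.Product using (_×_; ∃!)
open import Function.Bundles using (_⇔_)
open import Relation.Binary.PropositionalEquality using (_≡_; _≢_; _≗_)
open import Relation.Nullary using (¬_)

open import Data.Bool.Base using (Bool; true; false; not; _∨_)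
open import Data.Bool.Properties using (⇔→≡; not-involutive)
open import Data.Empty using (⊥-elim)
open import Data.Fin.Base using (zero; suc; toℕ; fromℕ; inject₁)
open import Data.Fin.Induction using (<-weakInduction)
import Data.Fin.Properties as Fin
open import Data.Fin.Relation.Unary.Top using (view; ‵fromℕ; ‵inject₁)
open import Data.Integer.Base using (ℤ; 0ℤ; -1ℤ; _≤_; +≤+) renaming (+_ to pos)
import Data.Integer.Properties as ℤ
open import Data.Integer.Tactic.RingSolver using (solve-∀)
open import Data.List.Base using (allFin; filter; take)
import Data.List.Extrema as Extrema
open import Data.List.Membership.Propositional.Properties
  using (∈-allFin; ∈-filter⁺; ∈-filter⁻)
import Data.List.Relation.Unary.All as All
open import Data.Nat.Base as ℕ using (z≤n)
import Data.Nat.Properties as ℕ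
open import Data.Product using (_,_; proj₁; proj₂)
open import Data.Sum.Base using (inj₁; inj₂)
open import Data.Vec.Base using (Vec; _∷_; lookup; tabulate; toList)
open import Data.Vec.Properties using (lookup∘tabulate; tabulate∘lookup; tabulate-cong)
open import Function.Base using (_∘_)
open import Function.Bundles using (mk⇔; module Equivalence)
open import Function.Construct.Composition using (_⇔-∘_)
open import Function.Construct.Symmetry using (⇔-sym)
open import Relation.Binary.Definitions using (tri<; tri≈; tri>)
open import Relation.Binary.PropositionalEquality
  using (refl; sym; trans; cong; cong₂; subst; subst₂; module ≡-Reasoning)
open import Relation.Nullary using (yes; no; does)
open import Relation.Nullary.Decidable
  using (recompute; dec-true; dec-false; _×-dec_; _⊎-dec_; _→-dec_)

open Equivalence using (to; from)

private variable
  n : ℕ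

-- Bits as integers

⟦_⟧ : Bool → ℤ
⟦ true  ⟧ = 1ℤ
⟦ false ⟧ = 0ℤ

⟦not⟧ : ∀ b → ⟦ not b ⟧ ≡ 1ℤ - ⟦ b ⟧
⟦not⟧ true  = refl
⟦not⟧ false = refl

⟦⟧-injective : ∀ {a b} → ⟦ a ⟧ ≡ ⟦ b ⟧ → a ≡ b
⟦⟧-injective {true}  {true}  _ = refl
⟦⟧-injective {false} {false} _ = refl

0≤⟦_⟧ : ∀ b → 0ℤ ≤ ⟦ b ⟧
0≤⟦ true  ⟧ = +≤+ z≤n
0≤⟦ false ⟧ = +≤+ z≤n

-- Steps as pairs of bits

isNE isES : Step → Bool
isNE N  = true
isNE S  = false
isNE E  = true
isNE dE = false
isES N  = false
isES S  = true
isES E  = true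
isES dE = false

fromBits : Bool → Bool → Step
fromBits true  true  = E
fromBits true  false = N
fromBits false true  = S
fromBits false false = dE

isNE-fromBits : ∀ a b → isNE (fromBits a b) ≡ a
isNE-fromBits true  true  = refl
isNE-fromBits true  false = refl
isNE-fromBits false true  = refl
isNE-fromBits false false = refl

isES-fromBits : ∀ a b → isES (fromBits a b) ≡ b
isES-fromBits true  true  = refl
isES-fromBits true  false = refl
isES-fromBits false true  = refl
isES-fromBits false false = refl

fromBits-bits : ∀ s → fromBits (isNE s) (isES s) ≡ s
fromBits-bits N  = refl
fromBits-bits S  = refl
fromBits-bits E  = refl
fromBits-bits dE = refl

bits-injective : ∀ {s t} → isNE s ≡ isNE t → isES s ≡ isES t → s ≡ t
bits-injective {s} {t} p q =
  trans (sym (fromBits-bits s)) (trans (cong₂ fromBits p q) (fromBits-bits t))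

∈[N,E]⇔ : ∀ s → s ∈[N,E] ⇔ (isNE s ≡ true)
∈[N,E]⇔ N  = mk⇔ (λ _ → refl) (λ _ → inj₁ refl)
∈[N,E]⇔ E  = mk⇔ (λ _ → refl) (λ _ → inj₂ refl)
∈[N,E]⇔ S  = mk⇔ (λ { (inj₁ ()) ; (inj₂ ()) }) (λ ())
∈[N,E]⇔ dE = mk⇔ (λ { (inj₁ ()) ; (inj₂ ()) }) (λ ())

∈[S,dE]⇔ : ∀ s → s ∈[S,dE] ⇔ (not (isNE s) ≡ true)
∈[S,dE]⇔ S  = mk⇔ (λ _ → refl) (λ _ → inj₁ refl)
∈[S,dE]⇔ dE = mk⇔ (λ _ → refl) (λ _ → inj₂ refl)
∈[S,dE]⇔ N  = mk⇔ (λ { (inj₁ ()) ; (inj₂ ()) }) (λ ())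
∈[S,dE]⇔ E  = mk⇔ (λ { (inj₁ ()) ; (inj₂ ()) }) (λ ())

isNE⇒∉[S,dE] : ∀ {s} → isNE s ≡ true → ¬ s ∈[S,dE]
isNE⇒∉[S,dE] () (inj₁ refl)
isNE⇒∉[S,dE] () (inj₂ refl)

¬isNE⇒∉[N,E] : ∀ {s} → isNE s ≡ false → ¬ s ∈[N,E]
¬isNE⇒∉[N,E] () (inj₁ refl)
¬isNE⇒∉[N,E] () (inj₂ refl)

-- Heights

increment : Step → ℤ
increment s = ⟦ isNE s ⟧ - ⟦ isES s ⟧

height-∷ : ∀ s (w : Vec Step n) k → height (s ∷ w) (suc k) ≡ increment s + height w k
height-∷ s w k = cases s
  where
  ups downs : ℤ
  ups   = pos (occurrences N (take k (toList w)))
  downs = pos (occurrences S (take k (toList w)))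

  up : ∀ x y → (1ℤ + x) - y ≡ 1ℤ + (x - y)
  up = solve-∀

  down : ∀ x y → x - (1ℤ + y) ≡ -1ℤ + (x - y)
  down = solve-∀

  level : ∀ x y → x - y ≡ 0ℤ + (x - y)
  level = solve-∀

  -- The two counts over the longer prefix reduce to `ups` and `downs` only once `s` is a
  -- constructor, hence the split into four cases.
  cases : ∀ s → height (s ∷ w) (suc k) ≡ increment s + (ups - downs)
  cases N  = up ups downs
  cases S  = down ups downs
  cases E  = level ups downs
  cases dE = level ups downs

height-suc : (w : Vec Step n) (i : Fin n) →
  height w (suc (toℕ i)) ≡ height w (toℕ i) + increment (lookup w i)
height-suc (s ∷ w) zero    = trans (height-∷ s w 0) (ℤ.+-comm (increment s) 0ℤ)
height-suc (s ∷ w) (suc i) = begin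
  height (s ∷ w) (suc (suc (toℕ i)))
    ≡⟨ height-∷ s w (suc (toℕ i)) ⟩
  increment s + height w (suc (toℕ i))
    ≡⟨ cong (increment s +_) (height-suc w i) ⟩
  increment s + (height w (toℕ i) + increment (lookup w i))
    ≡⟨ ℤ.+-assoc (increment s) _ _ ⟨
  (increment s + height w (toℕ i)) + increment (lookup w i)
    ≡⟨ cong (_+ increment (lookup w i)) (height-∷ s w (toℕ i)) ⟨
  height (s ∷ w) (suc (toℕ i)) + increment (lookup w i) ∎
  where open ≡-Reasoning

height-suc-inject₁ : (w : Vec Step (suc n)) (p : Fin n) →
  height w (toℕ (suc p)) ≡ height w (toℕ (inject₁ p)) + increment (lookup w (inject₁ p))
height-suc-inject₁ w p =
  subst (λ k → height w (suc k) ≡ height w (toℕ (inject₁ p)) + increment (lookup w (inject₁ p)))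
        (Fin.toℕ-inject₁ p) (height-suc w (inject₁ p))

height-last : (w : Vec Step (suc n)) →
  height w (suc n) ≡ height w (toℕ (fromℕ n)) + increment (lookup w (fromℕ n))
height-last {n} w =
  subst (λ k → height w (suc k) ≡ height w (toℕ (fromℕ n)) + increment (lookup w (fromℕ n)))
        (Fin.toℕ-fromℕ n) (height-suc w (fromℕ n))

-- Histories

History-≡ : {W V : History n} →
  (∀ i → step W i ≡ step V i) → (∀ i → label W i ≡ label V i) → W ≡ V
History-≡ {W = W} {V} p q = congruence (vec-≡ p) (vec-≡ q)
  where
  vec-≡ : ∀ {A : Set} {k} {xs ys : Vec A k} → lookup xs ≗ lookup ys → xs ≡ ys
  vec-≡ {xs = xs} {ys} e =
    trans (sym (tabulate∘lookup xs)) (trans (tabulate-cong e) (tabulate∘lookup ys))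

  congruence : word W ≡ word V → labels W ≡ labels V → W ≡ V
  congruence refl refl = refl

-- The field is irrelevant; as the condition is decidable, `recompute` turns it into a proof usable
-- in relevant positions.
motzkin : (W : History n) → IsMotzkin (word W)
motzkin {n} (history w _ mz _) = recompute
  (Fin.all? (λ i → 0ℤ ℤ.≤? height w (toℕ i)) ×-dec (height w n ℤ.≟ 0ℤ)) mz

validLabels : (W : History n) → ValidLabels (word W) (labels W)
validLabels (history w c _ v) = recompute
  (Fin.all? λ i →
    (((lookup w i ≟ N) ⊎-dec (lookup w i ≟ E)) →-dec
      ((0ℤ ℤ.≤? lookup c i) ×-dec (lookup c i ℤ.≤? height w (toℕ i))))
    ×-dec
    (((lookup w i ≟ S) ⊎-dec (lookup w i ≟ dE)) →-dec
      ((1ℤ ℤ.≤? lookup c i) ×-dec (lookup c i ℤ.≤? height w (toℕ i)))))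
  v

-- Writing the lower bound as a bit merges the two cases of the label condition, so that bounds can
-- be shifted by plain arithmetic.
LabelFits : Step → ℤ → ℤ → Set
LabelFits s c h = ⟦ not (isNE s) ⟧ ≤ c × c ≤ h

LabelFits⇔ : ∀ s {c h} → LabelFits s c h ⇔
  ((s ∈[N,E] → 0ℤ ≤ c × c ≤ h) × (s ∈[S,dE] → 1ℤ ≤ c × c ≤ h))
LabelFits⇔ N  = mk⇔ (λ b → (λ _ → b) , λ { (inj₁ ()) ; (inj₂ ()) }) (λ b → proj₁ b (inj₁ refl))
LabelFits⇔ E  = mk⇔ (λ b → (λ _ → b) , λ { (inj₁ ()) ; (inj₂ ()) }) (λ b → proj₁ b (inj₂ refl))
LabelFits⇔ S  = mk⇔ (λ b → (λ { (inj₁ ()) ; (inj₂ ()) }) , λ _ → b) (λ b → proj₂ b (inj₁ refl))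
LabelFits⇔ dE = mk⇔ (λ b → (λ { (inj₁ ()) ; (inj₂ ()) }) , λ _ → b) (λ b → proj₂ b (inj₂ refl))

label-fits : (W : History n) (i : Fin n) → LabelFits (step W i) (label W i) (ht W i)
label-fits W i = from (LabelFits⇔ (step W i)) (validLabels W i)

0≤label : (W : History n) (i : Fin n) → 0ℤ ≤ label W i
0≤label W i = ℤ.≤-trans 0≤⟦ not (isNE (step W i)) ⟧ (proj₁ (label-fits W i))

label≡0⇒isNE : (W : History n) (i : Fin n) → label W i ≡ 0ℤ → isNE (step W i) ≡ true
label≡0⇒isNE W i c≡0 =
  cases (isNE (step W i)) (subst (⟦ not (isNE (step W i)) ⟧ ≤_) c≡0 (proj₁ (label-fits W i)))
  where
  cases : ∀ b → ⟦ not b ⟧ ≤ 0ℤ → b ≡ true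
  cases true  _         = refl
  cases false (+≤+ ())

-- The path ends at height zero. A final N would have to start at height -1, and a final dE at
-- height 0, where no label `1ℤ ≤ c` fits.
last-isES : (W : History (suc n)) → isES (step W (fromℕ n)) ≡ true
last-isES {n} W = cases (step W (fromℕ n)) (label-fits W (fromℕ n)) (begin
  ht W (fromℕ n) + increment (step W (fromℕ n)) ≡⟨ height-last (word W) ⟨
  height (word W) (suc n)                       ≡⟨ proj₂ (motzkin W) ⟩
  0ℤ                                            ∎)
  where
  open ≡-Reasoning
  cases : ∀ s {c h} → LabelFits s c h → h + increment s ≡ 0ℤ → isES s ≡ true
  cases S  _ _ = refl
  cases E  _ _ = refl
  cases N {h = h} (0≤c , c≤h) h+1≡0
    with +≤+ () ← ℤ.≤-trans (ℤ.+-monoˡ-≤ 1ℤ (ℤ.≤-trans 0≤c c≤h)) (ℤ.≤-reflexive h+1≡0)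
  cases dE {h = h} (1≤c , c≤h) h+0≡0
    with +≤+ () ← ℤ.≤-trans (ℤ.+-monoˡ-≤ 0ℤ (ℤ.≤-trans 1≤c c≤h)) (ℤ.≤-reflexive h+0≡0)

-- The critical step

IsCritical : History n → Fin n → Set
IsCritical W m = label W m ≡ 0ℤ × (∀ i → m < i → label W i ≢ 0ℤ)

-- The maximum is either a member of the filtered list or the base value `zero`; the latter also
-- carries label zero, since its label lies between 0 and the initial height 0. A later zero label
-- would belong to the list and exceed its maximum.
cs-isCritical : (W : History (suc n)) → IsCritical W (cs W)
cs-isCritical {n} W = zero-label , λ i m<i c≡0 →
  ℕ.<⇒≱ m<i (All.lookup (Max.xs≤max zero zeros) (∈-filter⁺ zero? (∈-allFin i) c≡0))
  where
  module Max = Extrema (Fin.≤-totalOrder (suc n))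
  zero? = λ i → label W i ℤ.≟ 0ℤ
  zeros = filter zero? (allFin (suc n))

  label-zero : label W zero ≡ 0ℤ
  label-zero = ℤ.≤-antisym (proj₂ (label-fits W zero)) (0≤label W zero)

  zero-label : label W (cs W) ≡ 0ℤ
  zero-label with Max.argmax-sel (λ i → i) zero zeros
  ... | inj₁ m≡zero = trans (cong (label W) m≡zero) label-zero
  ... | inj₂ m∈     = proj₂ (∈-filter⁻ zero? {xs = allFin (suc n)} m∈)

critical-unique : (W : History n) {i j : Fin n} → IsCritical W i → IsCritical W j → i ≡ j
critical-unique W {i} {j} (ci , >i) (cj , >j) with Fin.<-cmp i j
... | tri< i<j _ _ = ⊥-elim (>i j i<j cj)
... | tri≈ _ i≡j _ = i≡j
... | tri> _ _ j<i = ⊥-elim (>j i j<i ci)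

-- The reflected path

opposite-< : {i j : Fin n} → i < j → opposite j < opposite i
opposite-< {n} {i} {j} i<j = begin-strict
  toℕ (opposite j)   ≡⟨ Fin.opposite-prop j ⟩
  n ℕ.∸ suc (toℕ j)  <⟨ ℕ.∸-monoʳ-< (ℕ.s<s i<j) (Fin.toℕ<n j) ⟩
  n ℕ.∸ suc (toℕ i)  ≡⟨ Fin.opposite-prop i ⟨
  toℕ (opposite i)   ∎
  where open ℕ.≤-Reasoning

opposite-<ˡ : {i j : Fin n} → opposite i < j → opposite j < i
opposite-<ˡ {i = i} p = subst (_ <_) (Fin.opposite-involutive i) (opposite-< p)

opposite-<ʳ : {i j : Fin n} → i < opposite j → j < opposite i
opposite-<ʳ {j = j} p = subst (_< _) (Fin.opposite-involutive j) (opposite-< p)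

opposite-injective : {i j : Fin n} → opposite i ≡ opposite j → i ≡ j
opposite-injective {i = i} {j} e = trans (sym (Fin.opposite-involutive i))
  (trans (cong opposite e) (Fin.opposite-involutive j))

opposite-≢ : {j m : Fin n} → j ≢ opposite m → opposite j ≢ m
opposite-≢ {j = j} j≢ k≡m = j≢ (trans (sym (Fin.opposite-involutive j)) (cong opposite k≡m))

opposite-inject₁ : (i : Fin n) → opposite (inject₁ i) ≡ suc (opposite i)
opposite-inject₁ zero    = refl
opposite-inject₁ (suc i) = cong inject₁ (opposite-inject₁ i)

-- `opposite zero` computes to `fromℕ n`, so this is involutivity at `zero`.
opposite-fromℕ : ∀ n → opposite (fromℕ n) ≡ zero
opposite-fromℕ n = Fin.opposite-involutive zero

-- The indicator of `m ≤ k` jumps exactly when `k` reaches `m`. In the telescoping of heights this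
-- jump compensates for the unflipped bit of the critical step.
⟦≤suc⟧ : (m : Fin (suc n)) (p : Fin n) → ⟦ does (m Fin.≤? suc p) ⟧ ≡
  ⟦ does (m Fin.≤? inject₁ p) ⟧ + ⟦ does (suc p Fin.≟ m) ⟧
⟦≤suc⟧ zero          p       = refl
⟦≤suc⟧ (suc zero)    zero    = refl
⟦≤suc⟧ (suc (suc q)) zero    = refl
⟦≤suc⟧ (suc zero)    (suc p) = refl
⟦≤suc⟧ (suc (suc q)) (suc p) = ⟦≤suc⟧ (suc q) p

module _ (W : History (suc n)) (m : Fin (suc n)) where

  -- At `m` the disjunction forces `true`: a critical step is N or E in both histories because its
  -- label is zero.
  reflectedNE : Fin (suc n) → Bool
  reflectedNE k = does (k Fin.≟ m) ∨ not (isNE (step W k))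

  -- The first position has no predecessor; its value true is what makes the
  -- reflected path end at height zero (compare last-isES).
  reflectedES : Fin (suc n) → Bool
  reflectedES zero    = true
  reflectedES (suc p) = not (isES (step W (inject₁ p)))

  shift : Fin (suc n) → ℤ
  shift k = ⟦ isNE (step W k) ⟧ - ⟦ does (m Fin.≤? k) ⟧

  shift-< : ∀ {k} → k < m → shift k ≡ ⟦ isNE (step W k) ⟧ - 0ℤ
  shift-< {k} k<m =
    cong (λ b → ⟦ isNE (step W k) ⟧ - ⟦ b ⟧) (dec-false (m Fin.≤? k) (ℕ.<⇒≱ k<m))

  shift-≥ : ∀ {k} → toℕ m ℕ.≤ toℕ k → shift k ≡ ⟦ isNE (step W k) ⟧ - 1ℤ
  shift-≥ {k} m≤k =
    cong (λ b → ⟦ isNE (step W k) ⟧ - ⟦ b ⟧) (dec-true (m Fin.≤? k) m≤k)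

  reflectedNE-≡ : ∀ {k} → k ≡ m → reflectedNE k ≡ true
  reflectedNE-≡ {k} k≡m = cong (_∨ not (isNE (step W k))) (dec-true (k Fin.≟ m) k≡m)

  reflectedNE-≢ : ∀ {k} → k ≢ m → reflectedNE k ≡ not (isNE (step W k))
  reflectedNE-≢ {k} k≢m = cong (_∨ not (isNE (step W k))) (dec-false (k Fin.≟ m) k≢m)

  reflectedStep : Fin (suc n) → Step
  reflectedStep j = fromBits (reflectedNE (opposite j)) (reflectedES (opposite j))

  reflectedLabel : Fin (suc n) → ℤ
  reflectedLabel j = shift (opposite j) + label W (opposite j)

  reflectedWord : Vec Step (suc n)
  reflectedWord = tabulate reflectedStep

  reflectedLabels : Vec ℤ (suc n)
  reflectedLabels = tabulate reflectedLabel

  reflectedWord-isNE : ∀ j → isNE (lookup reflectedWord j) ≡ reflectedNE (opposite j)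
  reflectedWord-isNE j =
    trans (cong isNE (lookup∘tabulate reflectedStep j))
      (isNE-fromBits (reflectedNE (opposite j)) (reflectedES (opposite j)))

  reflectedWord-isES : ∀ j → isES (lookup reflectedWord j) ≡ reflectedES (opposite j)
  reflectedWord-isES j =
    trans (cong isES (lookup∘tabulate reflectedStep j))
      (isES-fromBits (reflectedNE (opposite j)) (reflectedES (opposite j)))

  reflectedWord-increment : ∀ {k} j → opposite j ≡ k →
    increment (lookup reflectedWord j) ≡ ⟦ reflectedNE k ⟧ - ⟦ reflectedES k ⟧
  reflectedWord-increment j refl =
    cong₂ (λ a b → ⟦ a ⟧ - ⟦ b ⟧) (reflectedWord-isNE j) (reflectedWord-isES j)

  module _ (critical : IsCritical W m) where

    -- The disjunction becomes a sum because its two sides are never both true: at `m` the step is N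
    -- or E, so its flipped bit vanishes.
    ⟦reflectedNE⟧ : ∀ k →
      ⟦ reflectedNE k ⟧ ≡ (1ℤ - ⟦ isNE (step W k) ⟧) + ⟦ does (k Fin.≟ m) ⟧
    ⟦reflectedNE⟧ k with k Fin.≟ m
    ... | yes refl rewrite label≡0⇒isNE W k (proj₁ critical) = refl
    ... | no _ = trans (⟦not⟧ (isNE (step W k))) (sym (ℤ.+-identityʳ _))

    -- Induction on `j` moves backwards through `W`. Delaying the ES bits makes each of them meet
    -- its own negation from the adjacent step of `W`, so the sum telescopes.
    reflectedWord-height : ∀ j →
      height reflectedWord (toℕ j) ≡ ht W (opposite j) + shift (opposite j)
    reflectedWord-height = <-weakInduction _ base ascend
      where
      open ≡-Reasoning

      -- The initial height 0 is read as the final height of `W`. The last ES bit is 1, so the last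
      -- increment is exactly the shift there.
      base : 0ℤ ≡ ht W (fromℕ n) + shift (fromℕ n)
      base = begin
        0ℤ                                             ≡⟨ proj₂ (motzkin W) ⟨
        height (word W) (suc n)                        ≡⟨ height-last (word W) ⟩
        ht W (fromℕ n) + increment (step W (fromℕ n))
          ≡⟨ cong (λ b → ht W (fromℕ n) + (⟦ isNE (step W (fromℕ n)) ⟧ - ⟦ b ⟧)) (last-isES W) ⟩
        ht W (fromℕ n) + (⟦ isNE (step W (fromℕ n)) ⟧ - 1ℤ)
          ≡⟨ cong (ht W (fromℕ n) +_) (shift-≥ (Fin.≤fromℕ m)) ⟨
        ht W (fromℕ n) + shift (fromℕ n)               ∎

      regroup : ∀ h x d y t e →
        ((h + (x - d)) + (y - (t + e))) + (((1ℤ - y) + e) - (1ℤ - d)) ≡ h + (x - t)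
      regroup = solve-∀

      ascend : ∀ i →
        height reflectedWord (toℕ (inject₁ i)) ≡
          ht W (opposite (inject₁ i)) + shift (opposite (inject₁ i)) →
        height reflectedWord (toℕ (suc i)) ≡
          ht W (opposite (suc i)) + shift (opposite (suc i))
      -- The step at `inject₁ i` reflects `suc p`, but its ES bit negates that of `inject₁ p`.
      -- Expanding the height of `W` across `inject₁ p` produces the same `d` with opposite sign;
      -- likewise the jump `e` of the indicator cancels the `e` in the NE bit.
      ascend i hyp = begin
        height reflectedWord (toℕ (suc i))
          ≡⟨ height-suc-inject₁ reflectedWord i ⟩
        height reflectedWord (toℕ (inject₁ i)) + increment (lookup reflectedWord (inject₁ i))
          ≡⟨ cong₂ _+_
               (trans hyp (cong (λ k → ht W k + shift k) (opposite-inject₁ i)))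
               (reflectedWord-increment (inject₁ i) (opposite-inject₁ i)) ⟩
        (ht W (suc p) + (⟦ y ⟧ - ⟦ does (m Fin.≤? suc p) ⟧))
          + (⟦ reflectedNE (suc p) ⟧ - ⟦ not d ⟧)
          ≡⟨ cong₂ _+_
               (cong₂ _+_ (height-suc-inject₁ (word W) p)
                          (cong (λ t → ⟦ y ⟧ - t) (⟦≤suc⟧ m p)))
               (cong₂ _-_ (⟦reflectedNE⟧ (suc p)) (⟦not⟧ d)) ⟩
        ((ht W (inject₁ p) + (⟦ x ⟧ - ⟦ d ⟧)) + (⟦ y ⟧ - (⟦ t ⟧ + ⟦ e ⟧)))
          + (((1ℤ - ⟦ y ⟧) + ⟦ e ⟧) - (1ℤ - ⟦ d ⟧))
          ≡⟨ regroup (ht W (inject₁ p)) ⟦ x ⟧ ⟦ d ⟧ ⟦ y ⟧ ⟦ t ⟧ ⟦ e ⟧ ⟩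
        ht W (inject₁ p) + shift (inject₁ p) ∎
        where
        p = opposite i
        x = isNE (step W (inject₁ p))
        d = isES (step W (inject₁ p))
        y = isNE (step W (suc p))
        t = does (m Fin.≤? inject₁ p)
        e = does (suc p Fin.≟ m)

    reflectedWord-end : height reflectedWord (suc n) ≡ 0ℤ
    reflectedWord-end = begin
      height reflectedWord (suc n)
        ≡⟨ height-last reflectedWord ⟩
      height reflectedWord (toℕ (fromℕ n)) + increment (lookup reflectedWord (fromℕ n))
        ≡⟨ cong₂ _+_
             (trans (reflectedWord-height (fromℕ n))
                    (cong (λ k → ht W k + shift k) (opposite-fromℕ n)))
             (reflectedWord-increment (fromℕ n) (opposite-fromℕ n)) ⟩
      -- Here `0ℤ` is the initial height of `W`, and `1ℤ` is the value chosen for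
      -- `reflectedES zero`.
      (0ℤ + shift zero) + (⟦ reflectedNE zero ⟧ - 1ℤ)
        ≡⟨ cong₂ (λ t r → (0ℤ + (⟦ x ⟧ - t)) + (r - 1ℤ)) (⟦≤zero⟧ m) (⟦reflectedNE⟧ zero) ⟩
      (0ℤ + (⟦ x ⟧ - ⟦ e ⟧)) + (((1ℤ - ⟦ x ⟧) + ⟦ e ⟧) - 1ℤ)
        ≡⟨ cancel ⟦ x ⟧ ⟦ e ⟧ ⟩
      0ℤ ∎
      where
      open ≡-Reasoning
      x = isNE (step W zero)
      e = does (zero Fin.≟ m)

      ⟦≤zero⟧ : ∀ m → ⟦ does (m Fin.≤? zero {n}) ⟧ ≡ ⟦ does (zero Fin.≟ m) ⟧
      ⟦≤zero⟧ zero    = refl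
      ⟦≤zero⟧ (suc _) = refl

      cancel : ∀ x e → (0ℤ + (x - e)) + (((1ℤ - x) + e) - 1ℤ) ≡ 0ℤ
      cancel = solve-∀

    -- The upper bound survives because label and height move by the same shift. The lower bound
    -- depends on the side of `m`: before it the shift is the new lower bound itself, at `m`
    -- everything is zero, and after it the shift may be -1.
    reflected-fits : ∀ k →
      ⟦ not (reflectedNE k) ⟧ ≤ shift k + label W k × shift k + label W k ≤ ht W k + shift k
    reflected-fits k = lower , subst (shift k + label W k ≤_) (ℤ.+-comm (shift k) (ht W k))
                                     (ℤ.+-monoʳ-≤ (shift k) (proj₂ (label-fits W k)))
      where
      lower-< : ∀ b {c} → 0ℤ ≤ c → ⟦ not (not b) ⟧ ≤ (⟦ b ⟧ - 0ℤ) + c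
      lower-< true  0≤c = ℤ.+-monoʳ-≤ 1ℤ 0≤c
      lower-< false 0≤c = ℤ.+-monoʳ-≤ 0ℤ 0≤c

      lower-> : ∀ b {c} → 1ℤ ≤ c → ⟦ not (not b) ⟧ ≤ (⟦ b ⟧ - 1ℤ) + c
      lower-> true  1≤c = ℤ.+-monoʳ-≤ 0ℤ 1≤c
      lower-> false 1≤c = ℤ.+-monoʳ-≤ -1ℤ 1≤c

      lower : ⟦ not (reflectedNE k) ⟧ ≤ shift k + label W k
      lower with Fin.<-cmp k m
      ... | tri< k<m k≢m _
        rewrite reflectedNE-≢ k≢m | shift-< k<m = lower-< (isNE (step W k)) (0≤label W k)
      ... | tri≈ _ refl _
        rewrite reflectedNE-≡ {k} refl | shift-≥ {k} ℕ.≤-refl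
              | label≡0⇒isNE W k (proj₁ critical) | proj₁ critical = +≤+ z≤n
      ... | tri> _ k≢m m<k
        rewrite reflectedNE-≢ k≢m | shift-≥ (ℕ.<⇒≤ m<k) =
        -- Beyond the critical step labels are nonzero, hence at least 1, which pays for a shift of
        -- -1.
        lower-> (isNE (step W k))
          (ℤ.i<j⇒suc[i]≤j (ℤ.≤∧≢⇒< (0≤label W k) (proj₂ critical k m<k ∘ sym)))

    reflectedLabels-fit : ∀ j → LabelFits (lookup reflectedWord j) (lookup reflectedLabels j)
      (height reflectedWord (toℕ j))
    reflectedLabels-fit j =
      subst₂ _≤_ (cong (⟦_⟧ ∘ not) (sym (reflectedWord-isNE j))) label-eq
        (proj₁ (reflected-fits (opposite j))) ,
      subst₂ _≤_ label-eq (sym (reflectedWord-height j)) (proj₂ (reflected-fits (opposite j)))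
      where label-eq = sym (lookup∘tabulate reflectedLabel j)

    reflect : History (suc n)
    reflect = history reflectedWord reflectedLabels (nonneg , reflectedWord-end)
      (λ j → to (LabelFits⇔ (lookup reflectedWord j)) (reflectedLabels-fit j))
      where
      nonneg : ∀ i → 0ℤ ≤ height reflectedWord (toℕ i)
      -- Below the final position the label is squeezed between a bit and the height, so
      -- nonnegativity follows from the label bounds.
      nonneg i with view i
      ... | ‵fromℕ = ℤ.≤-reflexive (sym (trans
        (cong (height reflectedWord) (Fin.toℕ-fromℕ (suc n))) reflectedWord-end))
      ... | ‵inject₁ j = subst (λ k → 0ℤ ≤ height reflectedWord k) (sym (Fin.toℕ-inject₁ j))
        (ℤ.≤-trans 0≤⟦ not (isNE (lookup reflectedWord j)) ⟧
          (ℤ.≤-trans (proj₁ (reflectedLabels-fit j)) (proj₂ (reflectedLabels-fit j))))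

-- Characterisation of the reflection

-- Abstracting the two side conditions of (3) lets each combination of them collapse to a single
-- equation for the height.
HeightCases : (Above Below : Set) → ℤ → ℤ → Set
HeightCases Above Below g h =
  (Above → g ≡ h + 1ℤ) × (Below → g ≡ h - 1ℤ) × (¬ Above → ¬ Below → g ≡ h)

heightCases-above : ∀ {A B g h} → A → ¬ B → HeightCases A B g h ⇔ (g ≡ h + 1ℤ)
heightCases-above a ¬b =
  mk⇔ (λ r → proj₁ r a) (λ e → (λ _ → e) , ⊥-elim ∘ ¬b , λ ¬a _ → ⊥-elim (¬a a))

heightCases-below : ∀ {A B g h} → ¬ A → B → HeightCases A B g h ⇔ (g ≡ h + -1ℤ)
heightCases-below ¬a b =
  mk⇔ (λ r → proj₁ (proj₂ r) b) (λ e → ⊥-elim ∘ ¬a , (λ _ → e) , λ _ ¬b → ⊥-elim (¬b b))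

heightCases-level : ∀ {A B g h} → ¬ A → ¬ B → HeightCases A B g h ⇔ (g ≡ h + 0ℤ)
heightCases-level {h = h} ¬a ¬b = mk⇔
  (λ r → trans (proj₂ (proj₂ r) ¬a ¬b) (sym (ℤ.+-identityʳ h)))
  (λ e → ⊥-elim ∘ ¬a , ⊥-elim ∘ ¬b , λ _ _ → trans e (ℤ.+-identityʳ h))

module _ (W V : History (suc n)) (m : Fin (suc n)) where

  HeightRule : Fin (suc n) → Set
  HeightRule j = HeightCases
    (j > opposite m × step V j ∈[S,dE]) (j < opposite m × step V j ∈[N,E])
    (ht V j) (ht W (opposite j))

  IsReflection : Set
  IsReflection =
    (cs V ≡ opposite m) ×
    ((j : Fin (suc n)) → j ≢ opposite m →
      (step V j ∈[N,E]) ⇔ (step W (opposite j) ∈[S,dE])) ×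
    ((j : Fin (suc n)) → HeightRule j) ×
    ((j : Fin (suc n)) →
      label V j ≡ (ht V j - ht W (opposite j)) + label W (opposite j))

  -- The closed form of the reflection. It is free of case distinctions on the new path and leaves
  -- the ES bits implicit, as they are determined by the heights.
  IsShifted : Set
  IsShifted =
    ((j : Fin (suc n)) → isNE (step V j) ≡ reflectedNE W m (opposite j)) ×
    ((j : Fin (suc n)) → ht V j ≡ ht W (opposite j) + shift W m (opposite j)) ×
    ((j : Fin (suc n)) → label V j ≡ shift W m (opposite j) + label W (opposite j))

  module _ (critical : IsCritical W m) where

    -- Before `m` the shift is 0 or 1, after it -1 or 0, and at `m` it is 0. Off `m` the NE bit is
    -- flipped, so the nonzero values occur exactly under the side conditions of (3).
    heightRule⇔ : ∀ j → isNE (step V j) ≡ reflectedNE W m (opposite j) →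
      HeightRule j ⇔ (ht V j ≡ ht W (opposite j) + shift W m (opposite j))
    heightRule⇔ j step≡ with Fin.<-cmp (opposite j) m
    ... | tri< k<m k≢m _ rewrite shift-< W m k<m =
      cases (isNE (step W (opposite j))) (trans step≡ (reflectedNE-≢ W m k≢m))
      where
      not-below : ¬ (j < opposite m × step V j ∈[N,E])
      not-below (j<m , _) = Fin.<-asym j<m (opposite-<ˡ k<m)

      cases : ∀ a → isNE (step V j) ≡ not a →
        HeightRule j ⇔ (ht V j ≡ ht W (opposite j) + (⟦ a ⟧ - 0ℤ))
      cases true  e = heightCases-above
        (opposite-<ˡ k<m , from (∈[S,dE]⇔ (step V j)) (cong not e)) not-below
      cases false e = heightCases-level (isNE⇒∉[S,dE] e ∘ proj₂) not-below
    ... | tri> _ k≢m m<k rewrite shift-≥ W m (ℕ.<⇒≤ m<k) =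
      cases (isNE (step W (opposite j))) (trans step≡ (reflectedNE-≢ W m k≢m))
      where
      not-above : ¬ (j > opposite m × step V j ∈[S,dE])
      not-above (m<j , _) = Fin.<-asym m<j (opposite-<ʳ m<k)

      cases : ∀ a → isNE (step V j) ≡ not a →
        HeightRule j ⇔ (ht V j ≡ ht W (opposite j) + (⟦ a ⟧ - 1ℤ))
      cases true  e = heightCases-level not-above (¬isNE⇒∉[N,E] e ∘ proj₂)
      cases false e = heightCases-below not-above
        (opposite-<ʳ m<k , from (∈[N,E]⇔ (step V j)) e)
    ... | tri≈ _ refl _
      rewrite shift-≥ W m {m} ℕ.≤-refl | label≡0⇒isNE W m (proj₁ critical)
            | Fin.opposite-involutive j =
      heightCases-level (Fin.<-irrefl refl ∘ proj₁) (Fin.<-irrefl refl ∘ proj₁)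

    isShifted⇒cs : IsShifted → cs V ≡ opposite m
    isShifted⇒cs (_ , _ , labels≡) = critical-unique V (cs-isCritical V) (at , after)
      where
      at : label V (opposite m) ≡ 0ℤ
      at = trans (labels≡ (opposite m))
        (subst (λ k → shift W m k + label W k ≡ 0ℤ) (sym (Fin.opposite-involutive m))
          (cong₂ _+_
            (trans (shift-≥ W m {m} ℕ.≤-refl)
                   (cong (λ b → ⟦ b ⟧ - 1ℤ) (label≡0⇒isNE W m (proj₁ critical))))
            (proj₁ critical)))

      -- Positions after `opposite m` reflect those before `m`. There the label of an N or E step
      -- grows by 1, while that of an S or dE step is already at least 1.
      nonzero : ∀ k → k < m → shift W m k + label W k ≢ 0ℤ
      nonzero k k<m rewrite shift-< W m k<m = cases (isNE (step W k)) (label-fits W k)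
        where
        cases : ∀ b {c h} → ⟦ not b ⟧ ≤ c × c ≤ h → (⟦ b ⟧ - 0ℤ) + c ≢ 0ℤ
        cases true  (+≤+ _ , _)             ()
        cases false (+≤+ (ℕ.s≤s _) , _) ()

      after : ∀ j → opposite m < j → label V j ≢ 0ℤ
      after j m<j b≡0 = nonzero (opposite j) (opposite-<ˡ m<j) (trans (sym (labels≡ j)) b≡0)

    isShifted⇒isReflection : IsShifted → IsReflection
    isShifted⇒isReflection shifted@(steps≡ , heights≡ , labels≡) =
      isShifted⇒cs shifted , classes , heights , labels′
      where
      classes : ∀ j → j ≢ opposite m → (step V j ∈[N,E]) ⇔ (step W (opposite j) ∈[S,dE])
      classes j j≢ =
        ⇔-sym (∈[S,dE]⇔ (step W (opposite j))) ⇔-∘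
          (mk⇔ (trans (sym step≡)) (trans step≡) ⇔-∘ ∈[N,E]⇔ (step V j))
        where
        step≡ : isNE (step V j) ≡ not (isNE (step W (opposite j)))
        step≡ = trans (steps≡ j) (reflectedNE-≢ W m (opposite-≢ j≢))

      labels′ : ∀ j → label V j ≡ (ht V j - ht W (opposite j)) + label W (opposite j)
      labels′ j = trans (labels≡ j) (cong (_+ label W (opposite j))
        (trans (cancel (ht W (opposite j)) _) (cong (_- ht W (opposite j)) (sym (heights≡ j)))))
        where
        cancel : ∀ h s → s ≡ (h + s) - h
        cancel = solve-∀

      heights : ∀ j → HeightRule j
      heights j = from (heightRule⇔ j (steps≡ j)) (heights≡ j)

    isReflection⇒isShifted : IsReflection → IsShifted
    isReflection⇒isShifted (cs≡ , classes , heights , labels≡) =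
      steps≡ , heights≡ , labels′
      where
      steps≡ : ∀ j → isNE (step V j) ≡ reflectedNE W m (opposite j)
      steps≡ j with j Fin.≟ opposite m
      -- Condition (2) is silent at this position; by (1) it is the critical step of `V`, whose zero
      -- label forces N or E.
      ... | yes refl = trans
        (label≡0⇒isNE V j (trans (cong (label V) (sym cs≡)) (proj₁ (cs-isCritical V))))
        (sym (reflectedNE-≡ W m (Fin.opposite-involutive m)))
      ... | no j≢ = trans
        (⇔→≡ (∈[S,dE]⇔ (step W (opposite j)) ⇔-∘ (classes j j≢ ⇔-∘ ⇔-sym (∈[N,E]⇔ (step V j)))))
        (sym (reflectedNE-≢ W m (opposite-≢ j≢)))

      heights≡ : ∀ j → ht V j ≡ ht W (opposite j) + shift W m (opposite j)
      heights≡ j = to (heightRule⇔ j (steps≡ j)) (heights j)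

      labels′ : ∀ j → label V j ≡ shift W m (opposite j) + label W (opposite j)
      labels′ j = trans (labels≡ j) (cong (_+ label W (opposite j))
        (trans (cong (_- ht W (opposite j)) (heights≡ j)) (cancel (ht W (opposite j)) _)))
        where
        cancel : ∀ h s → (h + s) - h ≡ s
        cancel = solve-∀

-- Uniqueness of the shifted history

isShifted-unique : (W V V′ : History (suc n)) (m : Fin (suc n)) →
  IsShifted W V m → IsShifted W V′ m → V ≡ V′
isShifted-unique {n} W V V′ m (steps , heights , labs) (steps′ , heights′ , labs′) =
  History-≡ (λ j → bits-injective (isNE≡ j) (isES≡ j)) (λ j → trans (labs j) (sym (labs′ j)))
  where
  isNE≡ : ∀ j → isNE (step V j) ≡ isNE (step V′ j)
  isNE≡ j = trans (steps j) (sym (steps′ j))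

  ht≡ : ∀ j → ht V j ≡ ht V′ j
  ht≡ j = trans (heights j) (sym (heights′ j))

  height-suc≡ : ∀ j → height (word V) (suc (toℕ j)) ≡ height (word V′) (suc (toℕ j))
  height-suc≡ j with view j
  ... | ‵inject₁ i rewrite Fin.toℕ-inject₁ i = ht≡ (suc i)
  -- After the last step there is no further position to compare; both paths end at height zero.
  ... | ‵fromℕ rewrite Fin.toℕ-fromℕ n = trans (proj₂ (motzkin V)) (sym (proj₂ (motzkin V′)))

  -- With heights and NE bits already equal, the ES bit is what remains of the increment: current
  -- height plus NE bit minus next height.
  isES≡ : ∀ j → isES (step V j) ≡ isES (step V′ j)
  isES≡ j = ⟦⟧-injective (begin
    ⟦ isES (step V j) ⟧
      ≡⟨ solve-last (ht V j) ⟦ isNE (step V j) ⟧ _ ⟩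
    (ht V j + ⟦ isNE (step V j) ⟧) - (ht V j + increment (step V j))
      ≡⟨ cong ((ht V j + ⟦ isNE (step V j) ⟧) -_) (height-suc (word V) j) ⟨
    (ht V j + ⟦ isNE (step V j) ⟧) - height (word V) (suc (toℕ j))
      ≡⟨ cong₂ _-_ (cong₂ (λ h b → h + ⟦ b ⟧) (ht≡ j) (isNE≡ j)) (height-suc≡ j) ⟩
    (ht V′ j + ⟦ isNE (step V′ j) ⟧) - height (word V′) (suc (toℕ j))
      ≡⟨ cong ((ht V′ j + ⟦ isNE (step V′ j) ⟧) -_) (height-suc (word V′) j) ⟩
    (ht V′ j + ⟦ isNE (step V′ j) ⟧) - (ht V′ j + increment (step V′ j))
      ≡⟨ solve-last (ht V′ j) ⟦ isNE (step V′ j) ⟧ _ ⟨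
    ⟦ isES (step V′ j) ⟧ ∎)
    where
    open ≡-Reasoning
    solve-last : ∀ h a d → d ≡ (h + a) - (h + (a - d))
    solve-last = solve-∀

-- Symmetry of the closed form

module _ (W V : History (suc n)) (m : Fin (suc n)) (critical : IsCritical W m)
  (shifted : IsShifted W V m) where

  private
    m′ = opposite m

    isNE-opposite : ∀ k → isNE (step V (opposite k)) ≡ reflectedNE W m k
    isNE-opposite k =
      trans (proj₁ shifted (opposite k)) (cong (reflectedNE W m) (Fin.opposite-involutive k))

    ht-opposite : ∀ k → ht V (opposite k) ≡ ht W k + shift W m k
    ht-opposite k = trans (proj₁ (proj₂ shifted) (opposite k))
      (cong (λ k → ht W k + shift W m k) (Fin.opposite-involutive k))

    label-opposite : ∀ k → label V (opposite k) ≡ shift W m k + label W k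
    label-opposite k = trans (proj₂ (proj₂ shifted) (opposite k))
      (cong (λ k → shift W m k + label W k) (Fin.opposite-involutive k))

    -- Off `m`, reflection complements both the NE bit and the indicator of being at or beyond the
    -- critical step, so their difference changes sign. At `m` both shifts are zero.
    shift-opposite : ∀ k → shift V m′ (opposite k) ≡ 0ℤ - shift W m k
    shift-opposite k with Fin.<-cmp k m
    ... | tri< k<m k≢m _
      rewrite shift-≥ V m′ (ℕ.<⇒≤ (opposite-< k<m)) | shift-< W m k<m
            | isNE-opposite k | reflectedNE-≢ W m k≢m = cases (isNE (step W k))
      where
      cases : ∀ a → ⟦ not a ⟧ - 1ℤ ≡ 0ℤ - (⟦ a ⟧ - 0ℤ)
      cases true  = refl
      cases false = refl
    ... | tri≈ _ refl _
      rewrite shift-≥ V m′ {m′} ℕ.≤-refl | shift-≥ W m {m} ℕ.≤-refl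
            | isNE-opposite k | reflectedNE-≡ W m {k} refl
            | label≡0⇒isNE W m (proj₁ critical) = refl
    ... | tri> _ k≢m m<k
      rewrite shift-< V m′ (opposite-< m<k) | shift-≥ W m (ℕ.<⇒≤ m<k)
            | isNE-opposite k | reflectedNE-≢ W m k≢m = cases (isNE (step W k))
      where
      cases : ∀ a → ⟦ not a ⟧ - 0ℤ ≡ 0ℤ - (⟦ a ⟧ - 1ℤ)
      cases true  = refl
      cases false = refl

  isShifted-sym : IsShifted V W m′
  isShifted-sym = steps , heights , labels′
    where
    steps : ∀ k → isNE (step W k) ≡ reflectedNE V m′ (opposite k)
    steps k with k Fin.≟ m
    ... | yes refl =
      trans (label≡0⇒isNE W m (proj₁ critical)) (sym (reflectedNE-≡ V m′ refl))
    ... | no k≢m = sym (begin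
      reflectedNE V m′ (opposite k)      ≡⟨ reflectedNE-≢ V m′ (k≢m ∘ opposite-injective) ⟩
      not (isNE (step V (opposite k)))   ≡⟨ cong not (isNE-opposite k) ⟩
      not (reflectedNE W m k)            ≡⟨ cong not (reflectedNE-≢ W m k≢m) ⟩
      not (not (isNE (step W k)))        ≡⟨ not-involutive _ ⟩
      isNE (step W k)                    ∎)
      where open ≡-Reasoning

    heights : ∀ k → ht W k ≡ ht V (opposite k) + shift V m′ (opposite k)
    heights k = trans (cancel (ht W k) (shift W m k))
      (sym (cong₂ _+_ (ht-opposite k) (shift-opposite k)))
      where
      cancel : ∀ h s → h ≡ (h + s) + (0ℤ - s)
      cancel = solve-∀

    labels′ : ∀ k → label W k ≡ shift V m′ (opposite k) + label V (opposite k)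
    labels′ k = trans (cancel (label W k) (shift W m k))
      (sym (cong₂ _+_ (shift-opposite k) (label-opposite k)))
      where
      cancel : ∀ c s → c ≡ (0ℤ - s) + (s + c)
      cancel = solve-∀

-- The involution and its uniqueness

ξ : History (suc n) → History (suc n)
ξ W = reflect W (cs W) (cs-isCritical W)

ξ-isShifted : (W : History (suc n)) → IsShifted W (ξ W) (cs W)
ξ-isShifted W =
  reflectedWord-isNE W (cs W) ,
  reflectedWord-height W (cs W) (cs-isCritical W) ,
  lookup∘tabulate (reflectedLabel W (cs W))

-- By symmetry `W` is a shifted history of `ξ W`, and so is `ξ (ξ W)`; uniqueness identifies them
-- once both are taken at the same critical index.
ξ-involutive : Involutive _≡_ (ξ {n})
ξ-involutive W = isShifted-unique (ξ W) (ξ (ξ W)) W (opposite (cs W))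
  (subst (IsShifted (ξ W) (ξ (ξ W))) cs≡ (ξ-isShifted (ξ W)))
  (isShifted-sym W (ξ W) (cs W) (cs-isCritical W) (ξ-isShifted W))
  where
  cs≡ : cs (ξ W) ≡ opposite (cs W)
  cs≡ = isShifted⇒cs W (ξ W) (cs W) (cs-isCritical W) (ξ-isShifted W)

theorem3p2 : (n : ℕ) →
    ∃! _≗_ (λ (ξ : History (suc n) → History (suc n)) →
      Involutive _≡_ ξ ×
      ((W V : History (suc n)) (m : Fin (suc n)) → cs W ≡ m → V ≡ ξ W →
        (cs V ≡ opposite m) ×
        ((j : Fin (suc n)) → j ≢ opposite m →
          (step V j ∈[N,E]) ⇔ (step W (opposite j) ∈[S,dE])) ×
        ((j : Fin (suc n)) →
          (j > opposite m × step V j ∈[S,dE] → ht V j ≡ ht W (opposite j) + 1ℤ) ×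
          (j < opposite m × step V j ∈[N,E] → ht V j ≡ ht W (opposite j) - 1ℤ) ×
          (¬ (j > opposite m × step V j ∈[S,dE]) →
            ¬ (j < opposite m × step V j ∈[N,E]) → ht V j ≡ ht W (opposite j))) ×
        ((j : Fin (suc n)) →
          label V j ≡ (ht V j - ht W (opposite j)) + label W (opposite j))))
theorem3p2 n = ξ ,
  (ξ-involutive , λ { W _ _ refl refl →
    isShifted⇒isReflection W (ξ W) (cs W) (cs-isCritical W) (ξ-isShifted W) }) ,
  -- At each `W`, conditions (1) to (4) put `ξ′ W` into the closed form already satisfied by `ξ W`.
  λ { {ξ′} (_ , reflects) W → isShifted-unique W (ξ W) (ξ′ W) (cs W) (ξ-isShifted W)
    (isReflection⇒isShifted W (ξ′ W) (cs W) (cs-isCritical W)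
      (reflects W (ξ′ W) (cs W) refl refl)) }
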